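{- In every $4$-total coloring of a cubic graph of order $12$, the color class configuration is $(8,8,7,7)$ or $(8,8,8,6)$. Both configurations are attained by $4$-total colorings of the circular ladder $L_{12}$; in particular, $(8,8,8,6)$ is the unique configuration of a non-equitable $4$-total coloring of a cubic graph of order $12$.
   Context: All graphs are finite, simple and cubic ($3$-regular), not necessarily connected. The order of a graph is its number of vertices. A $4$-total coloring of $G$ assigns one of the four colors $1,2,3,4$ to each vertex and each edge of $G$ so that adjacent vertices receive distinct colors, adjacent edges (edges sharing an endpoint) receive distinct colors, and every vertex and edge that are incident receive distinct colors. The color class $c_i$ is the set of all vertices and edges of color $i$. The color class configuration of the coloring is the multiset $\{|c_1|,|c_2|,|c_3|,|c_4|\}$, written as a non-increasing sequence. The coloring is equitable if $\bigl||c_i|-|c_j|\bigr| \le 1$ for all $i,j \in \{1,2,3,4\}$, and non-equitable otherwise. For even $n\ge 6$, the circular ladder $L_n$ is the prism $C_{n/2} \,\square\, K_2$ (Cartesian product of a cycle on $n/2$ vertices with $K_2$), which has $n$ vertices; thus $L_{12} = C_6 \,\square\, K_2$. -}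

module Defs where

open import Data.Fin using (Fin; toℕ; _<_; remQuot)
open import Data.Fin.Properties using (toℕ<n; _<?_) renaming (_≟_ to _≟ᶠ_)
open import Data.List using (List; length; filter; map; mapMaybe; _++_; allFin; cartesianProduct)
open import Data.Maybe using (Maybe; just; nothing)
open import Data.Nat using (ℕ; suc; _+_; _*_; _≤_; z≤n; s≤s; _%_; ∣_-_∣)
open import Data.Nat.DivMod using (m<n⇒m%n≡m; n%n≡0)
open import Data.Nat.Properties using (1+n≢n; m≤n⇒m<n∨m≡n; _≟_)
open import Data.Product using (_×_; _,_)
open import Data.Sum using (_⊎_; inj₁; inj₂; swap; [_,_])
open import Relation.Binary.PropositionalEquality using (_≡_; _≢_; refl; sym; trans; cong)
open import Relation.Nullary using (¬_; Dec; yes; no)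
open import Relation.Nullary.Decidable using (_×-dec_; _⊎-dec_; ¬?)

record Graph (n : ℕ) : Set₁ where
  field
    Adj    : Fin n → Fin n → Set
    adj?   : ∀ u v → Dec (Adj u v)
    symm   : ∀ {u v} → Adj u v → Adj v u
    irrefl : ∀ {v} → ¬ Adj v v

  degree : Fin n → ℕ
  degree v = length (filter (adj? v) (allFin n))

  Cubic : Set
  Cubic = ∀ v → degree v ≡ 3

  -- An edge lists its endpoints in increasing order, with irrelevant proofs,
  -- so that each unordered pair of adjacent vertices is exactly one edge.
  record Edge : Set where
    constructor edge
    field
      lo hi     : Fin n
      .ordered  : lo < hi
      .adjacent : Adj lo hi

  _∈ᵉ_ : Fin n → Edge → Set
  w ∈ᵉ e = w ≡ Edge.lo e ⊎ w ≡ Edge.hi e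

  Element : Set
  Element = Fin n ⊎ Edge

  edge? : Fin n × Fin n → Maybe Edge
  edge? (u , v) with u <? v | adj? u v
  ... | yes u<v | yes uv = just (edge u v u<v uv)
  ... | _       | _      = nothing

  edges : List Edge
  edges = mapMaybe edge? (cartesianProduct (allFin n) (allFin n))

  elements : List Element
  elements = map inj₁ (allFin n) ++ map inj₂ edges

open Graph public using (Cubic)

record TotalColoring (k : ℕ) {n : ℕ} (G : Graph n) : Set where
  open Graph G
  field
    color         : Element → Fin k
    vertex-proper : ∀ {u v} → Adj u v → color (inj₁ u) ≢ color (inj₁ v)
    edge-proper   : ∀ {e f w} → e ≢ f → w ∈ᵉ e → w ∈ᵉ f → color (inj₂ e) ≢ color (inj₂ f)
    total-proper  : ∀ {w e} → w ∈ᵉ e → color (inj₁ w) ≢ color (inj₂ e)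

  colorClass : Fin k → List Element
  colorClass i = filter (λ x → color x ≟ᶠ i) elements

  classSize : Fin k → ℕ
  classSize i = length (colorClass i)

  -- Configurations are multisets: lists to be compared only up to permutation.
  configuration : List ℕ
  configuration = map classSize (allFin k)

  Equitable : Set
  Equitable = ∀ i j → ∣ classSize i - classSize j ∣ ≤ 1

open TotalColoring public using (configuration; Equitable)

private
  suc-%-≢ : ∀ {m} (i : Fin (2 + m)) → suc (toℕ i) % (2 + m) ≢ toℕ i
  suc-%-≢ {m} i eq with m≤n⇒m<n∨m≡n (toℕ<n i)
  ... | inj₁ 1+i<n = 1+n≢n (trans (sym (m<n⇒m%n≡m 1+i<n)) eq)
  ... | inj₂ 1+i≡n with trans (cong suc (trans (sym (n%n≡0 (2 + m))) (trans (cong (_% (2 + m)) (sym 1+i≡n)) eq))) 1+i≡n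
  ...   | ()

cycle : ∀ n → 3 ≤ n → Graph n
cycle n@(suc (suc _)) _ = record
  { Adj    = λ i j → suc (toℕ i) % n ≡ toℕ j ⊎ suc (toℕ j) % n ≡ toℕ i
  ; adj?   = λ i j → (suc (toℕ i) % n ≟ toℕ j) ⊎-dec (suc (toℕ j) % n ≟ toℕ i)
  ; symm   = swap
  ; irrefl = λ {i} → [ suc-%-≢ i , suc-%-≢ i ]
  }
cycle 1 (s≤s ())

complete : ∀ n → Graph n
complete n = record
  { Adj    = _≢_
  ; adj?   = λ u v → ¬? (u ≟ᶠ v)
  ; symm   = λ u≢v v≡u → u≢v (sym v≡u)
  ; irrefl = λ v≢v → v≢v refl
  }

-- Cartesian product; Fin (m * n) stands for Fin m × Fin n via remQuot.
infixr 7 _□_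
_□_ : ∀ {m n} → Graph m → Graph n → Graph (m * n)
_□_ {m} {n} G H = record
  { Adj    = λ u v → Adj□ (remQuot n u) (remQuot n v)
  ; adj?   = λ u v → adj□? (remQuot n u) (remQuot n v)
  ; symm   = [ (λ (p , a) → inj₁ (sym p , H.symm a)) , (λ (p , a) → inj₂ (sym p , G.symm a)) ]
  ; irrefl = [ (λ (_ , a) → H.irrefl a) , (λ (_ , a) → G.irrefl a) ]
  }
  where
  module G = Graph G
  module H = Graph H

  Adj□ : Fin m × Fin n → Fin m × Fin n → Set
  Adj□ (a , b) (a′ , b′) = (a ≡ a′ × H.Adj b b′) ⊎ (b ≡ b′ × G.Adj a a′)

  adj□? : ∀ p q → Dec (Adj□ p q)
  adj□? (a , b) (a′ , b′) = ((a ≟ᶠ a′) ×-dec H.adj? b b′) ⊎-dec ((b ≟ᶠ b′) ×-dec G.adj? a a′)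

-- Indexed by the length m of the cycle: the circular ladder of order 2m.
circularLadder : ∀ m → 3 ≤ m → Graph (m * 2)
circularLadder m 3≤m = cycle m 3≤m □ complete 2

L₁₂ : Graph 12
L₁₂ = circularLadder 6 (s≤s (s≤s (s≤s z≤n)))

{-# OPTIONS --safe #-}
-- In a 4-total coloring of a cubic graph every vertex, together with its three
-- edges, carries each color exactly once. Hence, if a color i occurs on aᵢ of the
-- 12 vertices and on bᵢ edges, aᵢ + 2bᵢ = 12. An edge of color i has no endpoint
-- of color i, and the aᵢ vertices of color i are independent, so 3aᵢ + bᵢ is at
-- most the number 18 of edges. Together these give 4 ≤ bᵢ ≤ 6, that is
-- |cᵢ| = 12 - bᵢ ∈ {6, 7, 8}. Since the four sizes add up to 12 + 18 = 30, they
-- are 8, 8, 7, 7 or 8, 8, 8, 6.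
module Submission where

open import Defs
open import Data.Bool using (if_then_else_; true; false)
open import Data.Empty using (⊥-elim; ⊥-elim-irr)
open import Data.Fin using (Fin; _<_; toℕ; remQuot; #_)
open import Data.Fin.Properties using (all?; <-asym; <-cmp) renaming (_≟_ to _≟ᶠ_; _<?_ to _<ᶠ?_)
open import Data.List using (List; []; _∷_; _++_; allFin; cartesianProduct; filter; length; map; mapMaybe)
open import Data.List.Membership.Propositional.Properties using (∈-allFin)
open import Data.List.Properties using (≡-dec; length-++; length-map; length-tabulate; map-++; map-∘; map-cong)
open import Data.List.Relation.Binary.Permutation.Propositional using (_↭_; ↭-reflexive; ↭-sym; ↭-trans)
open import Data.List.Relation.Binary.Permutation.Propositional.Properties using (All-resp-↭)
open import Data.List.Relation.Unary.All as All using (All; []; _∷_)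
open import Data.List.Relation.Unary.All.Properties using ()
  renaming (map⁺ to All-map⁺; map⁻ to All-map⁻; mapMaybe⁺ to All-mapMaybe⁺)
open import Data.List.Relation.Unary.AllPairs using (AllPairs; []; _∷_)
open import Data.List.Relation.Unary.AllPairs.Properties using () renaming (map⁺ to AllPairs-map⁺)
open import Data.List.Relation.Unary.Any using (Any; here; there)
open import Data.List.Relation.Unary.Unique.Propositional using (Unique)
open import Data.List.Relation.Unary.Unique.Propositional.Properties using (allFin⁺)
open import Data.List.Sort.Base using (module SortingAlgorithm)
open import Data.List.Sort.InsertionSort using (insertionSort)
open import Data.Maybe using (Maybe; just; nothing; maybe′; _<∣>_)
import Data.Maybe.Relation.Unary.All as Maybe
open import Data.Nat using (ℕ; suc; _+_; _*_; _≤_; z≤n; s≤s; _%_; ∣_-_∣)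
open import Data.Nat.ListAction using (sum)
open import Data.Nat.ListAction.Properties using (sum-++)
open import Data.Nat.Properties using (≤-refl; ≤-trans; ≤-reflexive; ≤-antisym; ≤-decTotalOrder;
  _≟_; _≤?_; +-identityʳ; +-mono-≤; +-monoʳ-≤;
  +-cancelˡ-≡; +-cancelʳ-≡; +-cancelʳ-≤; *-cancelˡ-≡; *-zeroʳ;
  *-identityʳ; *-distribˡ-+; m≤m+n; m≤n+m; module ≤-Reasoning)
open import Data.Nat.Solver using (module +-*-Solver)
open import Data.Product using (_×_; _,_; proj₁; proj₂; Σ-syntax; ∃-syntax)
open import Data.Sum as Sum using (_⊎_; inj₁; inj₂; [_,_]′)
open import Data.Vec using (Vec; []; _∷_; lookup)
open import Function using (_∘_)
open import Function.Bundles using (_⇔_; mk⇔)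
open import Relation.Binary.Definitions using (tri<; tri≈; tri>)
open import Relation.Binary.PropositionalEquality using (_≡_; _≢_; refl; sym; trans; cong; cong₂; subst; module ≡-Reasoning)
open import Relation.Nullary using (¬_; Dec; yes; no; does)
open import Relation.Nullary.Decidable using (_×-dec_; _⊎-dec_; _→-dec_; ¬?; from-yes; from-no; recompute)

-- Sums over lists

∑ : ∀ {A : Set} → List A → (A → ℕ) → ℕ
∑ xs f = sum (map f xs)

-- The Iverson bracket. Like `filter`, it inspects only `does`, so a count by `filter` and a sum of
-- brackets unfold in step.
[_] : ∀ {P : Set} → Dec P → ℕ
[ P? ] = if does P? then 1 else 0

module _ {A : Set} where

  ∑-cong : ∀ (xs : List A) {f g : A → ℕ} → (∀ x → f x ≡ g x) → ∑ xs f ≡ ∑ xs g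
  ∑-cong xs f≗g = cong sum (map-cong f≗g xs)

  ∑-++ : ∀ (xs ys : List A) (f : A → ℕ) → ∑ (xs ++ ys) f ≡ ∑ xs f + ∑ ys f
  ∑-++ xs ys f = trans (cong sum (map-++ f xs ys)) (sum-++ (map f xs) (map f ys))

  ∑-map : ∀ {B : Set} (g : B → A) (xs : List B) (f : A → ℕ) → ∑ (map g xs) f ≡ ∑ xs (f ∘ g)
  ∑-map g xs f = cong sum (sym (map-∘ xs))

  ∑-mapMaybe : ∀ {B : Set} (g : B → Maybe A) (xs : List B) (f : A → ℕ) →
               ∑ (mapMaybe g xs) f ≡ ∑ xs (maybe′ f 0 ∘ g)
  ∑-mapMaybe g []       f = refl
  ∑-mapMaybe g (x ∷ xs) f with g x
  ... | just y  = cong (f y +_) (∑-mapMaybe g xs f)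
  ... | nothing = ∑-mapMaybe g xs f

  ∑-const : ∀ (xs : List A) (c : ℕ) → ∑ xs (λ _ → c) ≡ length xs * c
  ∑-const []       c = refl
  ∑-const (x ∷ xs) c = cong (c +_) (∑-const xs c)

  ∑-1 : ∀ (xs : List A) → ∑ xs (λ _ → 1) ≡ length xs
  ∑-1 xs = trans (∑-const xs 1) (*-identityʳ _)

  ∑-+ : ∀ (xs : List A) (f g : A → ℕ) → ∑ xs (λ x → f x + g x) ≡ ∑ xs f + ∑ xs g
  ∑-+ []       f g = refl
  ∑-+ (x ∷ xs) f g = trans (cong (f x + g x +_) (∑-+ xs f g))
    (solve 4 (λ a b c d → (a :+ b) :+ (c :+ d) := (a :+ c) :+ (b :+ d)) refl (f x) (g x) (∑ xs f) (∑ xs g))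
    where open +-*-Solver

  ∑-*ˡ : ∀ (xs : List A) (c : ℕ) (f : A → ℕ) → ∑ xs (λ x → c * f x) ≡ c * ∑ xs f
  ∑-*ˡ []       c f = sym (*-zeroʳ c)
  ∑-*ˡ (x ∷ xs) c f = trans (cong (c * f x +_) (∑-*ˡ xs c f)) (sym (*-distribˡ-+ c (f x) (∑ xs f)))

  ∑-mono : ∀ (xs : List A) {f g : A → ℕ} → (∀ x → f x ≤ g x) → ∑ xs f ≤ ∑ xs g
  ∑-mono []       f≤g = z≤n
  ∑-mono (x ∷ xs) f≤g = +-mono-≤ (f≤g x) (∑-mono xs f≤g)

  ∑-cartesianProduct : ∀ {B : Set} (xs : List A) (ys : List B) (f : A × B → ℕ) →
                       ∑ (cartesianProduct xs ys) f ≡ ∑ xs (λ x → ∑ ys (λ y → f (x , y)))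
  ∑-cartesianProduct []       ys f = refl
  ∑-cartesianProduct (x ∷ xs) ys f =
    trans (cong sum (map-++ f (map (x ,_) ys) _))
      (trans (sum-++ (map f (map (x ,_) ys)) _)
        (cong₂ _+_ (cong sum (sym (map-∘ ys))) (∑-cartesianProduct xs ys f)))

  -- Equal totals leave no slack: from `g x + ∑ xs g ≡ f x + ∑ xs f ≤ f x + ∑ xs
  -- g`, cancelling the tail gives `g x ≤ f x`.
  ∑-tight : ∀ (xs : List A) {f g : A → ℕ} →
            (∀ x → f x ≤ g x) → ∑ xs f ≡ ∑ xs g → All (λ x → f x ≡ g x) xs
  ∑-tight []       f≤g eq = []
  ∑-tight (x ∷ xs) {f} {g} f≤g eq =
    fx≡gx ∷ ∑-tight xs f≤g (+-cancelˡ-≡ (g x) _ _ (trans (cong (_+ ∑ xs f) (sym fx≡gx)) eq))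
    where
    fx≡gx : f x ≡ g x
    fx≡gx = ≤-antisym (f≤g x) (+-cancelʳ-≤ (∑ xs g) _ _
      (≤-trans (≤-reflexive (sym eq)) (+-monoʳ-≤ (f x) (∑-mono xs f≤g))))

  module _ {P : A → Set} (P? : ∀ x → Dec (P x)) where

    length-filter≡∑ : ∀ xs → length (filter P? xs) ≡ ∑ xs (λ x → [ P? x ])
    length-filter≡∑ []       = refl
    length-filter≡∑ (x ∷ xs) with does (P? x)
    ... | true  = cong suc (length-filter≡∑ xs)
    ... | false = length-filter≡∑ xs

    ∑-none : ∀ {xs} → All (¬_ ∘ P) xs → ∑ xs (λ x → [ P? x ]) ≡ 0
    ∑-none []                 = refl
    ∑-none {x ∷ _} (¬p ∷ ¬ps) with P? x
    ... | yes p = ⊥-elim (¬p p)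
    ... | no _  = ∑-none ¬ps

    ∑-atMostOne : ∀ {xs} → (∀ {x y} → P x → P y → x ≡ y) → Unique xs → ∑ xs (λ x → [ P? x ]) ≤ 1
    ∑-atMostOne         P-unique []         = z≤n
    ∑-atMostOne {x ∷ _} P-unique (x∉ ∷ xs!) with P? x
    ... | yes p = ≤-reflexive (cong suc (∑-none (All.map (λ x≢y q → x≢y (P-unique p q)) x∉)))
    ... | no _  = ∑-atMostOne P-unique xs!

    ∑-atLeastOne : ∀ {xs} → Any P xs → 1 ≤ ∑ xs (λ x → [ P? x ])
    ∑-atLeastOne {x ∷ _} (here p) with P? x
    ... | yes _ = s≤s z≤n
    ... | no ¬p = ⊥-elim (¬p p)
    ∑-atLeastOne {x ∷ _} (there ps) = ≤-trans (∑-atLeastOne ps) (m≤n+m _ [ P? x ])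

∑-swap : ∀ {A B : Set} (xs : List A) (ys : List B) (f : A → B → ℕ) →
         ∑ xs (λ x → ∑ ys (f x)) ≡ ∑ ys (λ y → ∑ xs (λ x → f x y))
∑-swap []       ys f = sym (trans (∑-const ys 0) (*-zeroʳ (length ys)))
∑-swap (x ∷ xs) ys f = trans (cong (∑ ys (f x) +_) (∑-swap xs ys f)) (sym (∑-+ ys (f x) _))

∑-[≟] : ∀ {k} (c : Fin k) → ∑ (allFin k) (λ i → [ c ≟ᶠ i ]) ≡ 1
∑-[≟] {k} c = ≤-antisym
  (∑-atMostOne (c ≟ᶠ_) (λ p q → trans (sym p) q) (allFin⁺ k))
  (∑-atLeastOne (c ≟ᶠ_) (∈-allFin c))

length-allFin : ∀ n → length (allFin n) ≡ n
length-allFin n = length-tabulate {n = n} (λ i → i)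

-- Each element occurs at most once, and the k numbers of occurrences add up to k.
∑-[≟]-unique : ∀ {k} {xs : List (Fin k)} → Unique xs → length xs ≡ k → ∀ i → ∑ xs (λ x → [ x ≟ᶠ i ]) ≡ 1
∑-[≟]-unique {k} {xs} xs! len i = All.lookup (∑-tight (allFin k) atMostOne total) (∈-allFin i)
  where
  open ≡-Reasoning
  atMostOne : ∀ i → ∑ xs (λ x → [ x ≟ᶠ i ]) ≤ 1
  atMostOne i = ∑-atMostOne (_≟ᶠ i) (λ p q → trans p (sym q)) xs!
  total : ∑ (allFin k) (λ i → ∑ xs (λ x → [ x ≟ᶠ i ])) ≡ ∑ (allFin k) (λ _ → 1)
  total = begin
    ∑ (allFin k) (λ i → ∑ xs (λ x → [ x ≟ᶠ i ])) ≡⟨ ∑-swap (allFin k) xs _ ⟩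
    ∑ xs (λ x → ∑ (allFin k) (λ i → [ x ≟ᶠ i ])) ≡⟨ ∑-cong xs ∑-[≟] ⟩
    ∑ xs (λ _ → 1)                               ≡⟨ ∑-1 xs ⟩
    length xs                                    ≡⟨ len ⟩
    k                                            ≡⟨ length-allFin k ⟨
    length (allFin k)                            ≡⟨ ∑-1 (allFin k) ⟨
    ∑ (allFin k) (λ _ → 1)                       ∎

-- Entries sent to `nothing` disappear, so injectivity is demanded only where the value is a `just`.
mapMaybe-unique : ∀ {A B : Set} (f : A → Maybe B) →
                  (∀ {x y z} → f x ≡ just z → f y ≡ just z → x ≡ y) →
                  ∀ {xs} → Unique xs → Unique (mapMaybe f xs)
mapMaybe-unique f f-inj []                    = []
mapMaybe-unique f f-inj {x ∷ _} (x∉ ∷ xs!) with f x in fx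
... | nothing = mapMaybe-unique f f-inj xs!
... | just z  = All-mapMaybe⁺ (All-map⁺ (All.map distinct x∉)) ∷ mapMaybe-unique f f-inj xs!
  where
  distinct : ∀ {y} → x ≢ y → Maybe.All (z ≢_) (f y)
  distinct {y} x≢y with f y in fy
  ... | nothing = Maybe.nothing
  ... | just _  = Maybe.just (λ z≡z′ → x≢y (f-inj fx (trans fy (cong just (sym z≡z′)))))

-- Meant for the edges at a vertex: `edge-proper` asks that two edges differ and also that both
-- contain the vertex, which is known entry by entry.
AllPairs-zipAll : ∀ {A : Set} {P : A → Set} {R S : A → A → Set} →
                  (∀ {x y} → P x → P y → R x y → S x y) →
                  ∀ {xs} → All P xs → AllPairs R xs → AllPairs S xs
AllPairs-zipAll f []         []         = []
AllPairs-zipAll f (px ∷ pxs) (rx ∷ rxs) =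
  All.zipWith (λ (py , r) → f px py r) (pxs , rx) ∷ AllPairs-zipAll f pxs rxs

-- Incidence

module _ {n : ℕ} (G : Graph n) where
  open Graph G

  edge?-just : ∀ {u v e} → edge? (u , v) ≡ just e → Edge.lo e ≡ u × Edge.hi e ≡ v
  edge?-just {u} {v} eq with u <ᶠ? v | adj? u v
  edge?-just refl | yes _ | yes _ = refl , refl
  edge?-just ()   | yes _ | no _
  edge?-just ()   | no _  | yes _
  edge?-just ()   | no _  | no _

  edge?-asym : ∀ {u v e} → edge? (u , v) ≡ just e → edge? (v , u) ≡ nothing
  edge?-asym {u} {v} eq with u <ᶠ? v | adj? u v | v <ᶠ? u | adj? v u
  edge?-asym eq | yes u<v | yes _ | yes v<u | yes _ = ⊥-elim (<-asym u<v v<u)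
  edge?-asym eq | yes _   | yes _ | yes _   | no _  = refl
  edge?-asym eq | yes _   | yes _ | no _    | yes _ = refl
  edge?-asym eq | yes _   | yes _ | no _    | no _  = refl
  edge?-asym () | yes _   | no _  | _       | _
  edge?-asym () | no _    | yes _ | _       | _
  edge?-asym () | no _    | no _  | _       | _

  edge?-adjacent : ∀ {u v} → u < v → Adj u v → ∃[ e ] edge? (u , v) ≡ just e
  edge?-adjacent {u} {v} u<v uv with u <ᶠ? v | adj? u v
  ... | yes _  | yes _  = _ , refl
  ... | yes _  | no ¬uv = ⊥-elim (¬uv uv)
  ... | no u≮v | _      = ⊥-elim (u≮v u<v)

  edge?-nonadjacent : ∀ {u v} → ¬ Adj u v → edge? (u , v) ≡ nothing
  edge?-nonadjacent {u} {v} ¬uv with u <ᶠ? v | adj? u v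
  ... | yes _ | yes uv = ⊥-elim (¬uv uv)
  ... | yes _ | no _   = refl
  ... | no _  | yes _  = refl
  ... | no _  | no _   = refl

  -- `edge?` answers only for increasing pairs, so both orders are tried.
  link : Fin n → Fin n → Maybe Edge
  link w x = edge? (w , x) <∣> edge? (x , w)

  -- Running over the possible other endpoints makes this list comparable, term by term, with the
  -- sum that computes `degree`.
  incident : Fin n → List Edge
  incident w = mapMaybe (link w) (allFin n)

  -- By `edge?-asym` at most one of the two orders yields an edge, so at most one summand is
  -- nonzero.
  maybe-link : ∀ (f : Edge → ℕ) w x →
               maybe′ f 0 (link w x) ≡ maybe′ f 0 (edge? (w , x)) + maybe′ f 0 (edge? (x , w))
  maybe-link f w x with edge? (w , x) in eq
  ... | nothing = refl
  ... | just e rewrite edge?-asym eq = sym (+-identityʳ (f e))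

  link-just : ∀ {w x e} → link w x ≡ just e →
              (w ≡ Edge.lo e × x ≡ Edge.hi e) ⊎ (w ≡ Edge.hi e × x ≡ Edge.lo e)
  link-just {w} {x} eq with edge? (w , x) in wx
  link-just refl | just _ with lo , hi ← edge?-just wx = inj₁ (sym lo , sym hi)
  link-just eq   | nothing with lo , hi ← edge?-just eq = inj₂ (sym hi , sym lo)

  link-injective : ∀ {w x y e} → link w x ≡ just e → link w y ≡ just e → x ≡ y
  link-injective wx wy with link-just wx | link-just wy
  ... | inj₁ (_ , x≡hi)    | inj₁ (_ , y≡hi)    = trans x≡hi (sym y≡hi)
  ... | inj₁ (w≡lo , x≡hi) | inj₂ (w≡hi , y≡lo) = trans x≡hi (trans (sym w≡hi) (trans w≡lo (sym y≡lo)))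
  ... | inj₂ (w≡hi , x≡lo) | inj₁ (w≡lo , y≡hi) = trans x≡lo (trans (sym w≡lo) (trans w≡hi (sym y≡hi)))
  ... | inj₂ (_ , x≡lo)    | inj₂ (_ , y≡lo)    = trans x≡lo (sym y≡lo)

  ∈-incident : ∀ w → All (w ∈ᵉ_) (incident w)
  ∈-incident w = All-mapMaybe⁺ {xs = allFin n} (All-map⁺ (All.universal ∈-link (allFin n)))
    where
    ∈-link : ∀ x → Maybe.All (w ∈ᵉ_) (link w x)
    ∈-link x with link w x in eq
    ... | nothing = Maybe.nothing
    ... | just _ with link-just eq
    ...   | inj₁ (w≡lo , _) = Maybe.just (inj₁ w≡lo)
    ...   | inj₂ (w≡hi , _) = Maybe.just (inj₂ w≡hi)

  incident-unique : ∀ w → Unique (incident w)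
  incident-unique w = mapMaybe-unique (link w) link-injective (allFin⁺ n)

  length-incident : ∀ w → length (incident w) ≡ degree w
  length-incident w = begin
    length (incident w)                                 ≡⟨ ∑-1 (incident w) ⟨
    ∑ (incident w) (λ _ → 1)                            ≡⟨ ∑-mapMaybe (link w) (allFin n) (λ _ → 1) ⟩
    ∑ (allFin n) (λ x → maybe′ (λ _ → 1) 0 (link w x))  ≡⟨ ∑-cong (allFin n) (λ x → linked x (adj? w x)) ⟩
    ∑ (allFin n) (λ x → [ adj? w x ])                   ≡⟨ length-filter≡∑ (adj? w) (allFin n) ⟨
    degree w                                            ∎
    where
    open ≡-Reasoning
    -- The decision is a separate argument, so that splitting on it leaves the `adj?` inside `edge?`
    -- for the rewrites.
    linked : ∀ x (wx? : Dec (Adj w x)) → maybe′ (λ _ → 1) 0 (link w x) ≡ [ wx? ]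
    linked x (no ¬wx) rewrite edge?-nonadjacent ¬wx | edge?-nonadjacent (¬wx ∘ symm) = refl
    linked x (yes wx) with <-cmp w x
    ... | tri< w<x _ _  rewrite proj₂ (edge?-adjacent w<x wx) = refl
    ... | tri≈ _ refl _ = ⊥-elim (irrefl wx)
    ... | tri> _ _ x<w with e , xw ← edge?-adjacent x<w (symm wx)
            rewrite edge?-asym xw | xw = refl

  -- Double counting of the pairs of an edge and one of its endpoints. The weight may depend on
  -- both: weight 1 counts the edges, a weight of the edge alone counts a color twice per edge, and
  -- a weight of the endpoint alone counts vertices with their degrees.
  handshake : ∀ (f : Fin n → Edge → ℕ) →
              ∑ edges (λ e → f (Edge.lo e) e + f (Edge.hi e) e) ≡ ∑ (allFin n) (λ w → ∑ (incident w) (f w))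
  handshake f = begin
    ∑ edges (λ e → f (Edge.lo e) e + f (Edge.hi e) e)
      ≡⟨ ∑-mapMaybe edge? (cartesianProduct V V) _ ⟩
    ∑ (cartesianProduct V V) (maybe′ (λ e → f (Edge.lo e) e + f (Edge.hi e) e) 0 ∘ edge?)
      ≡⟨ ∑-cartesianProduct V V _ ⟩
    ∑ V (λ u → ∑ V (λ v → maybe′ (λ e → f (Edge.lo e) e + f (Edge.hi e) e) 0 (edge? (u , v))))
      ≡⟨ ∑-cong V (λ u → trans (∑-cong V (split u)) (∑-+ V (out u) (into u))) ⟩
    ∑ V (λ u → ∑ V (out u) + ∑ V (into u))
      ≡⟨ ∑-+ V (λ u → ∑ V (out u)) (λ u → ∑ V (into u)) ⟩
    ∑ V (λ u → ∑ V (out u)) + ∑ V (λ u → ∑ V (into u))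
      -- The second sum is regrouped by upper endpoint, so that both sums can be merged at a common
      -- vertex `w`.
      ≡⟨ cong (∑ V (λ u → ∑ V (out u)) +_) (∑-swap V V into) ⟩
    ∑ V (λ u → ∑ V (out u)) + ∑ V (λ v → ∑ V (λ u → into u v))
      ≡⟨ ∑-+ V (λ u → ∑ V (out u)) (λ v → ∑ V (λ u → into u v)) ⟨
    ∑ V (λ w → ∑ V (out w) + ∑ V (λ x → into x w))
      ≡⟨ ∑-cong V gather ⟩
    ∑ V (λ w → ∑ (incident w) (f w)) ∎
    where
    open ≡-Reasoning
    V = allFin n
    out into : Fin n → Fin n → ℕ
    out  u v = maybe′ (f u) 0 (edge? (u , v))
    into u v = maybe′ (f v) 0 (edge? (u , v))
    split : ∀ u v → maybe′ (λ e → f (Edge.lo e) e + f (Edge.hi e) e) 0 (edge? (u , v)) ≡ out u v + into u v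
    split u v with edge? (u , v) in eq
    ... | nothing = refl
    ... | just e with refl , refl ← edge?-just eq = refl
    gather : ∀ w → ∑ V (out w) + ∑ V (λ x → into x w) ≡ ∑ (incident w) (f w)
    gather w = begin
      ∑ V (out w) + ∑ V (λ x → into x w)     ≡⟨ ∑-+ V (out w) (λ x → into x w) ⟨
      ∑ V (λ x → out w x + into x w)         ≡⟨ ∑-cong V (maybe-link (f w) w) ⟨
      ∑ V (λ x → maybe′ (f w) 0 (link w x))  ≡⟨ ∑-mapMaybe (link w) V (f w) ⟨
      ∑ (incident w) (f w)                   ∎

  module _ {d : ℕ} (regular : ∀ v → degree v ≡ d) where

    double-edges : length edges + length edges ≡ n * d
    double-edges = begin
      length edges + length edges                  ≡⟨ cong₂ _+_ (∑-1 edges) (∑-1 edges) ⟨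
      ∑ edges (λ _ → 1) + ∑ edges (λ _ → 1)        ≡⟨ ∑-+ edges (λ _ → 1) (λ _ → 1) ⟨
      ∑ edges (λ _ → 1 + 1)                        ≡⟨ handshake (λ _ _ → 1) ⟩
      ∑ (allFin n) (λ w → ∑ (incident w) (λ _ → 1))
        ≡⟨ ∑-cong (allFin n) (λ w → trans (∑-1 (incident w)) (trans (length-incident w) (regular w))) ⟩
      ∑ (allFin n) (λ _ → d)                       ≡⟨ ∑-const (allFin n) d ⟩
      length (allFin n) * d                        ≡⟨ cong (_* d) (length-allFin n) ⟩
      n * d                                        ∎
      where open ≡-Reasoning

  -- Color classes

  module _ {k : ℕ} (c : TotalColoring k G) where
    open TotalColoring c

    vertexCount edgeCount : Fin k → ℕ
    vertexCount i = ∑ (allFin n) (λ v → [ color (inj₁ v) ≟ᶠ i ])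
    edgeCount   i = ∑ edges (λ e → [ color (inj₂ e) ≟ᶠ i ])

    classSize-split : ∀ i → classSize i ≡ vertexCount i + edgeCount i
    classSize-split i = begin
      classSize i                                    ≡⟨ length-filter≡∑ (λ x → color x ≟ᶠ i) elements ⟩
      ∑ elements (λ x → [ color x ≟ᶠ i ])            ≡⟨ ∑-++ (map inj₁ (allFin n)) (map inj₂ edges) _ ⟩
      ∑ (map inj₁ (allFin n)) (λ x → [ color x ≟ᶠ i ]) + ∑ (map inj₂ edges) (λ x → [ color x ≟ᶠ i ])
        ≡⟨ cong₂ _+_ (∑-map inj₁ (allFin n) _) (∑-map inj₂ edges _) ⟩
      vertexCount i + edgeCount i                    ∎
      where open ≡-Reasoning

    -- Exchanging the sums, each element is counted once, for its only color.
    ∑-classSize : ∑ (allFin k) classSize ≡ n + length edges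
    ∑-classSize = begin
      ∑ (allFin k) classSize
        ≡⟨ ∑-cong (allFin k) (λ i → length-filter≡∑ (λ x → color x ≟ᶠ i) elements) ⟩
      ∑ (allFin k) (λ i → ∑ elements (λ x → [ color x ≟ᶠ i ]))
        ≡⟨ ∑-swap (allFin k) elements _ ⟩
      ∑ elements (λ x → ∑ (allFin k) (λ i → [ color x ≟ᶠ i ]))
        ≡⟨ ∑-cong elements (∑-[≟] ∘ color) ⟩
      ∑ elements (λ _ → 1)                                  ≡⟨ ∑-1 elements ⟩
      length elements                                       ≡⟨ length-++ (map inj₁ (allFin n)) ⟩
      length (map {B = Element} inj₁ (allFin n)) + length (map {B = Element} inj₂ edges)
        ≡⟨ cong₂ _+_ (trans (length-map inj₁ (allFin n)) (length-allFin n)) (length-map inj₂ edges) ⟩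
      n + length edges                                      ∎
      where open ≡-Reasoning

    starColors : Fin n → List (Fin k)
    starColors w = color (inj₁ w) ∷ map (color ∘ inj₂) (incident w)

    starColors-unique : ∀ w → Unique (starColors w)
    starColors-unique w =
      All-map⁺ (All.map total-proper (∈-incident w)) ∷
      AllPairs-map⁺ (AllPairs-zipAll (λ w∈e w∈f e≢f → edge-proper e≢f w∈e w∈f) (∈-incident w) (incident-unique w))

    -- An edge and its two endpoints are pairwise adjacent or incident, so their three colors are
    -- distinct.
    edge-atMostOne : ∀ i e →
      [ color (inj₁ (Edge.lo e)) ≟ᶠ i ] + [ color (inj₁ (Edge.hi e)) ≟ᶠ i ] + [ color (inj₂ e) ≟ᶠ i ] ≤ 1
    edge-atMostOne i e@(edge u v _ uv)
      with color (inj₁ u) ≟ᶠ i | color (inj₁ v) ≟ᶠ i | color (inj₂ e) ≟ᶠ i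
    -- The adjacency proof stored in an edge is irrelevant; decidability of `Adj` recovers a usable
    -- one.
    ... | yes p | yes q | _     = ⊥-elim (vertex-proper (recompute (adj? u v) uv) (trans p (sym q)))
    ... | yes p | no _  | yes r = ⊥-elim (total-proper {e = e} (inj₁ refl) (trans p (sym r)))
    ... | no _  | yes q | yes r = ⊥-elim (total-proper {e = e} (inj₂ refl) (trans q (sym r)))
    ... | yes _ | no _  | no _  = ≤-refl
    ... | no _  | yes _ | no _  = ≤-refl
    ... | no _  | no _  | yes _ = ≤-refl
    ... | no _  | no _  | no _  = z≤n

    -- `edge-atMostOne` is summed over all edges; by `handshake` each vertex of color `i` turns up
    -- as an endpoint `d` times.
    vertexCount-bound : ∀ {d} → (∀ v → degree v ≡ d) → ∀ i → d * vertexCount i + edgeCount i ≤ length edges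
    vertexCount-bound {d} regular i = begin
      d * vertexCount i + edgeCount i
        ≡⟨ cong (_+ edgeCount i) endpoints ⟨
      ∑ edges (λ e → at (Edge.lo e) + at (Edge.hi e)) + edgeCount i
        ≡⟨ ∑-+ edges _ _ ⟨
      ∑ edges (λ e → at (Edge.lo e) + at (Edge.hi e) + [ color (inj₂ e) ≟ᶠ i ])
        ≤⟨ ∑-mono edges (edge-atMostOne i) ⟩
      ∑ edges (λ _ → 1)
        ≡⟨ ∑-1 edges ⟩
      length edges ∎
      where
      open ≤-Reasoning
      at : Fin n → ℕ
      at v = [ color (inj₁ v) ≟ᶠ i ]
      endpoints : ∑ edges (λ e → at (Edge.lo e) + at (Edge.hi e)) ≡ d * vertexCount i
      endpoints = trans (handshake (λ w _ → at w))
        (trans (∑-cong (allFin n) (λ w → trans (∑-const (incident w) (at w))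
                                           (cong (_* at w) (trans (length-incident w) (regular w)))))
               (∑-*ˡ (allFin n) d at))

    -- A vertex and its edges are as many elements as there are colors, with distinct colors, so
    -- color `i` occurs exactly once among them. Summed over the vertices, a vertex of color `i` is
    -- counted once and an edge of color `i` twice.
    vertexCount+2edgeCount : (∀ v → suc (degree v) ≡ k) → ∀ i → vertexCount i + (edgeCount i + edgeCount i) ≡ n
    vertexCount+2edgeCount regular i = begin
      vertexCount i + (edgeCount i + edgeCount i)
        ≡⟨ cong (vertexCount i +_) (∑-+ edges on on) ⟨
      vertexCount i + ∑ edges (λ e → on e + on e)
        ≡⟨ cong (vertexCount i +_) (handshake (λ _ → on)) ⟩
      vertexCount i + ∑ (allFin n) (λ w → ∑ (incident w) on)
        ≡⟨ ∑-+ (allFin n) _ _ ⟨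
      ∑ (allFin n) (λ w → [ color (inj₁ w) ≟ᶠ i ] + ∑ (incident w) on)
        ≡⟨ ∑-cong (allFin n) star ⟩
      ∑ (allFin n) (λ _ → 1)
        ≡⟨ ∑-1 (allFin n) ⟩
      length (allFin n)
        ≡⟨ length-allFin n ⟩
      n ∎
      where
      open ≡-Reasoning
      on : Edge → ℕ
      on e = [ color (inj₂ e) ≟ᶠ i ]
      star : ∀ w → [ color (inj₁ w) ≟ᶠ i ] + ∑ (incident w) on ≡ 1
      star w = trans (cong ([ color (inj₁ w) ≟ᶠ i ] +_) (sym (∑-map (color ∘ inj₂) (incident w) _)))
        (∑-[≟]-unique (starColors-unique w)
          (trans (cong suc (trans (length-map (color ∘ inj₂) (incident w)) (length-incident w))) (regular w)) i)

-- Order 12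

-- With `a = 12 - 2b`, the value of `3 * a + b` is 36, 31, 26, 21 for `b` from 0 to 3, always above
-- 18, while `b ≥ 7` gives `b + b ≥ 14`. In the remaining cases `a + b = 12 - b`. Coding the size by
-- `Fin 3` prepares a finite search.
size∈678 : ∀ {a} b → a + (b + b) ≡ 12 → 3 * a + b ≤ 18 → ∃[ t ] a + b ≡ 6 + toℕ {3} t
size∈678 0 eq le = ⊥-elim (from-no (36 ≤? 18) (subst (λ a → 3 * a + 0 ≤ 18) (+-cancelʳ-≡ 0 _ 12 eq) le))
size∈678 1 eq le = ⊥-elim (from-no (31 ≤? 18) (subst (λ a → 3 * a + 1 ≤ 18) (+-cancelʳ-≡ 2 _ 10 eq) le))
size∈678 2 eq le = ⊥-elim (from-no (26 ≤? 18) (subst (λ a → 3 * a + 2 ≤ 18) (+-cancelʳ-≡ 4 _ 8 eq) le))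
size∈678 3 eq le = ⊥-elim (from-no (21 ≤? 18) (subst (λ a → 3 * a + 3 ≤ 18) (+-cancelʳ-≡ 6 _ 6 eq) le))
size∈678 4 eq le = # 2 , cong (_+ 4) (+-cancelʳ-≡ 8 _ 4 eq)
size∈678 5 eq le = # 1 , cong (_+ 5) (+-cancelʳ-≡ 10 _ 2 eq)
size∈678 6 eq le = # 0 , cong (_+ 6) (+-cancelʳ-≡ 12 _ 0 eq)
size∈678 {a} b@(suc (suc (suc (suc (suc (suc (suc m))))))) eq le =
  ⊥-elim (from-no (14 ≤? 12)
    (≤-trans (+-mono-≤ (m≤m+n 7 m) (m≤m+n 7 m)) (≤-trans (m≤n+m (b + b) a) (≤-reflexive eq))))

-- Size lists up to permutation

open SortingAlgorithm (insertionSort ≤-decTotalOrder) using (sort; sort-↭)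

-- Sorted lists serve as normal forms, so that a permutation can be found by deciding an equality.
sort-≡⇒↭ : ∀ {xs ys} → sort xs ≡ sort ys → xs ↭ ys
sort-≡⇒↭ {xs} {ys} eq = ↭-trans (↭-sym (sort-↭ xs)) (↭-trans (↭-reflexive eq) (sort-↭ ys))

sizes : Fin 3 → Fin 3 → Fin 3 → Fin 3 → List ℕ
sizes h i j k = map (λ t → 6 + toℕ t) (h ∷ i ∷ j ∷ k ∷ [])

-- Four sizes of at most 8 with sum 30 fall short of 32 by 2 in all: either two of them by 1 or one
-- by 2. The proof evaluates all 81 cases.
sort-sizes : ∀ h i j k → sum (sizes h i j k) ≡ 30 →
             sort (sizes h i j k) ≡ sort (8 ∷ 8 ∷ 7 ∷ 7 ∷ []) ⊎
             sort (sizes h i j k) ≡ sort (8 ∷ 8 ∷ 8 ∷ 6 ∷ [])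
sort-sizes = from-yes (all? λ h → all? λ i → all? λ j → all? λ k →
  (sum (sizes h i j k) ≟ 30) →-dec
  (≡-dec _≟_ (sort (sizes h i j k)) (sort (8 ∷ 8 ∷ 7 ∷ 7 ∷ [])) ⊎-dec
   ≡-dec _≟_ (sort (sizes h i j k)) (sort (8 ∷ 8 ∷ 8 ∷ 6 ∷ []))))

sizes-8877-or-8886 : ∀ (s : Fin 4 → ℕ) → (∀ i → ∃[ t ] s i ≡ 6 + toℕ {3} t) → ∑ (allFin 4) s ≡ 30 →
  map s (allFin 4) ↭ (8 ∷ 8 ∷ 7 ∷ 7 ∷ []) ⊎ map s (allFin 4) ↭ (8 ∷ 8 ∷ 8 ∷ 6 ∷ [])
sizes-8877-or-8886 s excess total
  with h , s₀ ← excess (# 0) | i , s₁ ← excess (# 1) | j , s₂ ← excess (# 2) | k , s₃ ← excess (# 3)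
  rewrite s₀ | s₁ | s₂ | s₃
  = Sum.map sort-≡⇒↭ sort-≡⇒↭ (sort-sizes h i j k total)

-- With the order a variable, the list of all edges does not unfold during type checking.
configuration-12 : ∀ {n} → n ≡ 12 → (G : Graph n) → Cubic G → (c : TotalColoring 4 G) →
  configuration c ↭ (8 ∷ 8 ∷ 7 ∷ 7 ∷ []) ⊎ configuration c ↭ (8 ∷ 8 ∷ 8 ∷ 6 ∷ [])
configuration-12 n≡12 G cubic c =
  sizes-8877-or-8886 classSize excess (trans (∑-classSize G c) (cong₂ _+_ n≡12 18-edges))
  where
  open Graph G using (edges)
  open TotalColoring c using (classSize)
  18-edges : length edges ≡ 18
  18-edges = *-cancelˡ-≡ _ _ 2
    (trans (cong (length edges +_) (+-identityʳ _)) (trans (double-edges G cubic) (cong (_* 3) n≡12)))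
  excess : ∀ i → ∃[ t ] classSize i ≡ 6 + toℕ {3} t
  excess i with t , eq ← size∈678 (edgeCount G c i)
                           (trans (vertexCount+2edgeCount G c (cong suc ∘ cubic) i) n≡12)
                           (≤-trans (vertexCount-bound G c cubic i) (≤-reflexive 18-edges))
    = t , trans (classSize-split G c i) eq

-- Having only the entries 8 and 7 survives permutation, so every class has one of these sizes.
equitable-8877 : ∀ {k n} {G : Graph n} (c : TotalColoring k G) →
                 configuration c ↭ (8 ∷ 8 ∷ 7 ∷ 7 ∷ []) → Equitable c
equitable-8877 {k} c config↭ i j with size∈78 i | size∈78 j
  where
  open TotalColoring c using (classSize)
  size∈78 : ∀ i → classSize i ≡ 8 ⊎ classSize i ≡ 7
  size∈78 i = All.lookup (All-map⁻ (All-resp-↭ {P = λ s → s ≡ 8 ⊎ s ≡ 7} (↭-sym config↭)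
    (inj₁ refl ∷ inj₁ refl ∷ inj₂ refl ∷ inj₂ refl ∷ []))) (∈-allFin i)
... | inj₁ p | inj₁ q rewrite p | q = z≤n
... | inj₁ p | inj₂ q rewrite p | q = ≤-refl
... | inj₂ p | inj₁ q rewrite p | q = ≤-refl
... | inj₂ p | inj₂ q rewrite p | q = z≤n

nonequitable-8886 : ∀ {n} → n ≡ 12 → (G : Graph n) → Cubic G → (c : TotalColoring 4 G) →
                    ¬ Equitable c → ∀ {ρ} → configuration c ↭ ρ → ρ ↭ (8 ∷ 8 ∷ 8 ∷ 6 ∷ [])
nonequitable-8886 n≡12 G cubic c ¬equitable config↭ρ =
  [ (λ config↭8877 → ⊥-elim (¬equitable (equitable-8877 c config↭8877)))
  , (λ config↭8886 → ↭-trans (↭-sym config↭ρ) config↭8886)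
  ]′ (configuration-12 n≡12 G cubic c)

-- Colorings of L₁₂

module _ {n k : ℕ} (G : Graph n) (vertexColor : Fin n → Fin k) (edgeColor : Fin n → Fin n → Fin k) where
  open Graph G

  -- Only vertices are quantified over, so the condition can be checked exhaustively. The color of
  -- an edge must not depend on its orientation, and the last clause is the contrapositive of
  -- properness for edges that share `w`.
  ProperAt : Fin n → Fin n → Set
  ProperAt w x = Adj w x →
    vertexColor w ≢ vertexColor x × vertexColor w ≢ edgeColor w x × edgeColor w x ≡ edgeColor x w ×
    (∀ y → Adj w y → edgeColor w x ≡ edgeColor w y → x ≡ y)

  properAt? : ∀ w x → Dec (ProperAt w x)
  properAt? w x = adj? w x →-dec
    (¬? (vertexColor w ≟ᶠ vertexColor x) ×-dec ¬? (vertexColor w ≟ᶠ edgeColor w x) ×-dec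
     (edgeColor w x ≟ᶠ edgeColor x w) ×-dec
     all? (λ y → adj? w y →-dec ((edgeColor w x ≟ᶠ edgeColor w y) →-dec (x ≟ᶠ y))))

  tabulateColoring : (∀ w x → ProperAt w x) → TotalColoring k G
  tabulateColoring proper = record
    { color         = color
    ; vertex-proper = λ {u} {v} uv → proj₁ (proper u v uv)
    ; edge-proper   = edge-proper
    ; total-proper  = λ {_} {e} → total-proper {e = e}
    }
    where
    color : Element → Fin k
    color (inj₁ v) = vertexColor v
    color (inj₂ e) = edgeColor (Edge.lo e) (Edge.hi e)

    adjacent : ∀ e → Adj (Edge.lo e) (Edge.hi e)
    adjacent (edge u v _ uv) = recompute (adj? u v) uv

    -- Both orientations of an edge carry the same color, so edges can be compared as seen from w.
    oriented : ∀ {w} e → w ∈ᵉ e → Σ[ x ∈ Fin n ] (Adj w x × color (inj₂ e) ≡ edgeColor w x ×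
               ((w ≡ Edge.lo e × x ≡ Edge.hi e) ⊎ (w ≡ Edge.hi e × x ≡ Edge.lo e)))
    oriented e (inj₁ refl) = _ , adjacent e , refl , inj₁ (refl , refl)
    oriented e (inj₂ refl) =
      _ , symm (adjacent e) , proj₁ (proj₂ (proj₂ (proper _ _ (adjacent e)))) , inj₂ (refl , refl)

    total-proper : ∀ {w e} → w ∈ᵉ e → color (inj₁ w) ≢ color (inj₂ e)
    total-proper {w} {e} w∈e eq with x , wx , e≡ , _ ← oriented e w∈e =
      proj₁ (proj₂ (proper w x wx)) (trans eq e≡)

    same-edge : ∀ {w x} e f →
      (w ≡ Edge.lo e × x ≡ Edge.hi e) ⊎ (w ≡ Edge.hi e × x ≡ Edge.lo e) →
      (w ≡ Edge.lo f × x ≡ Edge.hi f) ⊎ (w ≡ Edge.hi f × x ≡ Edge.lo f) → e ≡ f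
    same-edge e f (inj₁ (refl , refl)) (inj₁ (refl , refl)) = refl
    same-edge e f (inj₂ (refl , refl)) (inj₂ (refl , refl)) = refl
    -- Opposite orientations would make both endpoints smaller than each other; the order proofs are
    -- irrelevant, hence `⊥-elim-irr`.
    same-edge (edge _ _ u<v _) (edge _ _ v<u _) (inj₁ (refl , refl)) (inj₂ (refl , refl)) = ⊥-elim-irr (<-asym u<v v<u)
    same-edge (edge _ _ u<v _) (edge _ _ v<u _) (inj₂ (refl , refl)) (inj₁ (refl , refl)) = ⊥-elim-irr (<-asym u<v v<u)

    edge-proper : ∀ {e f w} → e ≢ f → w ∈ᵉ e → w ∈ᵉ f → color (inj₂ e) ≢ color (inj₂ f)
    edge-proper {e} {f} {w} e≢f w∈e w∈f eq
      with x , wx , e≡ , ends-e ← oriented e w∈e | y , wy , f≡ , ends-f ← oriented f w∈f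
      with refl ← proj₂ (proj₂ (proj₂ (proper w x wx))) y wy (trans (sym e≡) (trans eq f≡))
      = e≢f (same-edge e f ends-e ends-f)

-- Vertex 2a + b of L₁₂ is the vertex a of copy b of C₆; rails (2a + b) is the color of
-- the edge from it to the vertex a + 1 of the same copy, and rungs a the color of the
-- edge between the two copies of a.
ladderEdgeColor : Vec (Fin 4) 12 → Vec (Fin 4) 6 → Fin 12 → Fin 12 → Fin 4
ladderEdgeColor rails rungs u v =
  let a , _ = remQuot {6} 2 u
      b , _ = remQuot {6} 2 v
  in if does (a ≟ᶠ b) then lookup rungs a
     else if does (suc (toℕ a) % 6 ≟ toℕ b) then lookup rails u
     -- For adjacent vertices `v` now precedes `u` on the cycle, so the rail is indexed by `v`.
     -- Values at nonadjacent pairs are arbitrary.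
     else lookup rails v

module _ (vertices rails : Vec (Fin 4) 12) (rungs : Vec (Fin 4) 6) where

  ladderProper? : Dec (∀ w x → ProperAt L₁₂ (lookup vertices) (ladderEdgeColor rails rungs) w x)
  ladderProper? = all? λ w → all? λ x → properAt? L₁₂ (lookup vertices) (ladderEdgeColor rails rungs) w x

-- This is `c₈₈₈₆` after a Kempe exchange of colors 2 and 3 along the chain vertex 2, rung 1, rail
-- 1, rung 0, rail 10, rung 5, vertex 11. The chain has four elements of color 2 and three of color
-- 3, so the sizes 8 and 6 become 7 and 7.
c₈₈₇₇ : TotalColoring 4 L₁₂
c₈₈₇₇ = tabulateColoring L₁₂ _ _ (from-yes (ladderProper?
  (# 0 ∷ # 1 ∷ # 3 ∷ # 0 ∷ # 1 ∷ # 2 ∷ # 0 ∷ # 1 ∷ # 2 ∷ # 0 ∷ # 1 ∷ # 3 ∷ [])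
  (# 1 ∷ # 3 ∷ # 0 ∷ # 1 ∷ # 2 ∷ # 0 ∷ # 1 ∷ # 2 ∷ # 0 ∷ # 1 ∷ # 3 ∷ # 0 ∷ [])
  (# 2 ∷ # 2 ∷ # 3 ∷ # 3 ∷ # 3 ∷ # 2 ∷ [])))

-- Color 3 is the perfect matching of rungs; each copy of C₆ is colored cyclically by 0, 1, 2.
c₈₈₈₆ : TotalColoring 4 L₁₂
c₈₈₈₆ = tabulateColoring L₁₂ _ _ (from-yes (ladderProper?
  (# 0 ∷ # 1 ∷ # 2 ∷ # 0 ∷ # 1 ∷ # 2 ∷ # 0 ∷ # 1 ∷ # 2 ∷ # 0 ∷ # 1 ∷ # 2 ∷ [])
  (# 1 ∷ # 2 ∷ # 0 ∷ # 1 ∷ # 2 ∷ # 0 ∷ # 1 ∷ # 2 ∷ # 0 ∷ # 1 ∷ # 2 ∷ # 0 ∷ [])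
  (# 3 ∷ # 3 ∷ # 3 ∷ # 3 ∷ # 3 ∷ # 3 ∷ [])))

L₁₂-cubic : Cubic L₁₂
L₁₂-cubic = from-yes (all? λ v → Graph.degree L₁₂ v ≟ 3)

config-8877 : configuration c₈₈₇₇ ≡ 8 ∷ 8 ∷ 7 ∷ 7 ∷ []
config-8877 = from-yes (≡-dec _≟_ (configuration c₈₈₇₇) (8 ∷ 8 ∷ 7 ∷ 7 ∷ []))

config-8886 : configuration c₈₈₈₆ ≡ 8 ∷ 8 ∷ 8 ∷ 6 ∷ []
config-8886 = from-yes (≡-dec _≟_ (configuration c₈₈₈₆) (8 ∷ 8 ∷ 8 ∷ 6 ∷ []))

¬equitable-8886 : ¬ Equitable c₈₈₈₆
-- Classes 0 and 3 have sizes 8 and 6.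
¬equitable-8886 equitable = from-no (∣ classSize (# 0) - classSize (# 3) ∣ ≤? 1) (equitable (# 0) (# 3))
  where open TotalColoring c₈₈₈₆ using (classSize)

theorem5p2 : (∀ (G : Graph 12) → Cubic G → (c : TotalColoring 4 G) →
    configuration c ↭ (8 ∷ 8 ∷ 7 ∷ 7 ∷ []) ⊎ configuration c ↭ (8 ∷ 8 ∷ 8 ∷ 6 ∷ []))
    × (Σ[ c ∈ TotalColoring 4 L₁₂ ] configuration c ↭ (8 ∷ 8 ∷ 7 ∷ 7 ∷ []))
    × (Σ[ c ∈ TotalColoring 4 L₁₂ ] configuration c ↭ (8 ∷ 8 ∷ 8 ∷ 6 ∷ []))
    × (∀ (ρ : List ℕ) →
    (Σ[ G ∈ Graph 12 ] Cubic G × (Σ[ c ∈ TotalColoring 4 G ] (¬ Equitable c × configuration c ↭ ρ)))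
    ⇔ (ρ ↭ (8 ∷ 8 ∷ 8 ∷ 6 ∷ [])))
theorem5p2 =
  configuration-12 refl ,
  (c₈₈₇₇ , ↭-reflexive config-8877) ,
  (c₈₈₈₆ , ↭-reflexive config-8886) ,
  λ ρ → mk⇔
    (λ (G , cubic , c , ¬equitable , config↭ρ) → nonequitable-8886 refl G cubic c ¬equitable config↭ρ)
    -- One coloring witnesses every ordering `ρ` of the multiset.
    (λ ρ↭8886 → L₁₂ , L₁₂-cubic , c₈₈₈₆ , ¬equitable-8886 ,
                ↭-trans (↭-reflexive config-8886) (↭-sym ρ↭8886))
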